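{- For every fixed integer $t\ge 1$, $$\operatorname{ex}(n,W_t)=\Theta_t\bigl(\operatorname{ex}(n,C_8)\bigr),$$ where the implied constants depend only on $t$. More precisely, for every $n$, $$\operatorname{ex}(n,C_8)\le \operatorname{ex}(n,W_t)\le 2^{14(t-1)+2}\operatorname{ex}(n,C_8)+7(t-1)n .$$
   Context: All graphs are finite and simple. The extremal number $\operatorname{ex}(n,H)$ is the maximum number of edges in an $n$-vertex graph containing no (not necessarily induced) subgraph isomorphic to $H$. $C_8$ is the cycle with $8$ vertices. For an integer $t\ge 1$, $W_t$ is the graph obtained by taking $t$ vertex-disjoint copies of $C_8$ and identifying one vertex from each cycle into a single common vertex, so that any two of the $t$ cycles intersect exactly in this common vertex. -}

module Defs where

open import Data.Empty using (⊥; ⊥-elim)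
open import Data.Fin.Base as Fin using (Fin; zero; suc; toℕ; combine; remQuot; finToFun; funToFin)
import Data.Fin.Properties as Fin
open import Data.List.Base using (List; length; map; filter; allFin; cartesianProduct)
open import Data.List.Extrema.Nat using (max; xs≤max)
open import Data.List.Extrema as Extrema using ()
open import Data.List.Membership.Propositional.Properties
  using (∈-map⁺; ∈-map⁻; ∈-filter⁺; ∈-filter⁻; ∈-allFin)
open import Data.List.Properties using (filter-≐)
open import Data.List.Relation.Unary.All using (lookup)
open import Data.Nat.Base using (ℕ; _+_; _*_; _^_; _%_; _≤_; z≤n)
import Data.Nat.Properties as ℕ
open import Data.Product.Base using (∃; ∃-syntax; _×_; _,_; proj₁; proj₂; uncurry)
open import Data.Sum.Base using (_⊎_; inj₁; inj₂; swap)
open import Function.Base using (_∘_)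
open import Function.Definitions using (Injective)
open import Level using (0ℓ)
open import Relation.Binary.Core using (Rel)
open import Relation.Binary.Definitions
  using (Decidable; Symmetric; Irreflexive; tri<; tri≈; tri>)
open import Relation.Binary.PropositionalEquality
  using (_≡_; refl; sym; trans; cong; subst)
open import Relation.Nullary using (¬_; Dec; yes; no)
open import Relation.Nullary.Decidable
  using (map′; ¬?; _×-dec_; _⊎-dec_; _→-dec_; from-yes)

------------------------------------------------------------------------
-- Finite simple graphs

record Graph (n : ℕ) : Set₁ where
  field
    Adj    : Rel (Fin n) 0ℓ
    adj?   : Decidable Adj
    symm   : Symmetric Adj
    irrefl : Irreflexive _≡_ Adj

open Graph public

-- Each edge {u , v} is counted once, as the pair with u < v.
edges : ∀ {n} → Graph n → List (Fin n × Fin n)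
edges {n} G =
  filter (λ (u , v) → (u Fin.<? v) ×-dec adj? G u v)
         (cartesianProduct (allFin n) (allFin n))

edgeCount : ∀ {n} → Graph n → ℕ
edgeCount G = length (edges G)

IsEmbedding : ∀ {k n} → Graph k → Graph n → (Fin k → Fin n) → Set
IsEmbedding H G f =
  Injective _≡_ _≡_ f × (∀ u v → Adj H u v → Adj G (f u) (f v))

-- Not necessarily induced subgraphs.
Contains : ∀ {k n} → Graph n → Graph k → Set
Contains G H = ∃[ f ] IsEmbedding H G f

Free : ∀ {k n} → Graph k → Graph n → Set
Free H G = ¬ Contains G H

isEmbedding? : ∀ {k n} (H : Graph k) (G : Graph n) f → Dec (IsEmbedding H G f)
isEmbedding? H G f =
  map′ (λ inj {x} {y} → inj x y) (λ inj x y → inj {x} {y})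
       (Fin.all? λ x → Fin.all? λ y → (f x Fin.≟ f y) →-dec (x Fin.≟ y))
  ×-dec
  (Fin.all? λ u → Fin.all? λ v → adj? H u v →-dec adj? G (f u) (f v))

isEmbedding-resp : ∀ {k n} (H : Graph k) (G : Graph n) {f g : Fin k → Fin n} →
                   (∀ x → f x ≡ g x) → IsEmbedding H G f → IsEmbedding H G g
isEmbedding-resp H G {f} {g} f≗g (inj , hom) =
  (λ {x} {y} gx≡gy → inj (trans (f≗g x) (trans gx≡gy (sym (f≗g y))))) ,
  λ u v uv → subst (λ a → Adj G a (g v)) (f≗g u)
               (subst (Adj G (f u)) (f≗g v) (hom u v uv))

contains? : ∀ {k n} (G : Graph n) (H : Graph k) → Dec (Contains G H)
contains? G H =
  map′ (λ (c , emb) → finToFun c , emb)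
       (λ (f , emb) → funToFin f ,
          isEmbedding-resp H G (λ x → sym (Fin.finToFun-funToFin f x)) emb)
       (Fin.any? λ c → isEmbedding? H G (finToFun c))

free? : ∀ {k n} (H : Graph k) (G : Graph n) → Dec (Free H G)
free? H G = ¬? (contains? G H)

------------------------------------------------------------------------
-- Enumeration of all graphs on Fin n

-- A code is a 0/1-matrix, of which only the part above the diagonal is used.
decode : ∀ {n} → Fin (2 ^ (n * n)) → Graph n
decode {n} c = record
  { Adj    = λ u v → Upper u v ⊎ Upper v u
  ; adj?   = λ u v → upper? u v ⊎-dec upper? v u
  ; symm   = swap
  ; irrefl = λ { refl (inj₁ (u<u , _)) → ℕ.<-irrefl refl u<u
               ; refl (inj₂ (u<u , _)) → ℕ.<-irrefl refl u<u }
  }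
  where
  Upper : Fin n → Fin n → Set
  Upper u v = u Fin.< v × finToFun c (combine u v) ≡ suc zero

  upper? : ∀ u v → Dec (Upper u v)
  upper? u v = (u Fin.<? v) ×-dec (finToFun c (combine u v) Fin.≟ suc zero)

allGraphs : ∀ n → List (Graph n)
allGraphs n = map decode (allFin (2 ^ (n * n)))

-- The value 0 is the default when there is no H-free graph on n vertices;
-- this does not happen when H has an edge, see ex-attained.
ex : ∀ {k} → ℕ → Graph k → ℕ
ex n H = max 0 (map edgeCount (filter (free? H) (allGraphs n)))

------------------------------------------------------------------------
-- ex n H is the maximum of edgeCount over all H-free graphs on Fin n

_≈_ : ∀ {n} → Graph n → Graph n → Set
G ≈ G′ = ∀ u v → (Adj G u v → Adj G′ u v) × (Adj G′ u v → Adj G u v)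

edgeCount-resp : ∀ {n} (G G′ : Graph n) → G ≈ G′ → edgeCount G ≡ edgeCount G′
edgeCount-resp {n} G G′ G≈G′ = cong length
  (filter-≐ _ _
    ( (λ { {u , v} (u<v , uv) → u<v , proj₁ (G≈G′ u v) uv })
    , (λ { {u , v} (u<v , uv) → u<v , proj₂ (G≈G′ u v) uv }))
    (cartesianProduct (allFin n) (allFin n)))

free-resp : ∀ {k n} (H : Graph k) (G G′ : Graph n) → G ≈ G′ → Free H G → Free H G′
free-resp H G G′ G≈G′ free (f , inj , hom) =
  free (f , inj , λ u v uv → proj₂ (G≈G′ (f u) (f v)) (hom u v uv))

module _ {n : ℕ} (G : Graph n) where

  bit : Fin n → Fin n → Fin 2
  bit u v with adj? G u v
  ... | yes _ = suc zero
  ... | no  _ = zero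

  bit⁺ : ∀ {u v} → Adj G u v → bit u v ≡ suc zero
  bit⁺ {u} {v} uv with adj? G u v
  ... | yes _  = refl
  ... | no ¬uv = ⊥-elim (¬uv uv)

  bit⁻ : ∀ {u v} → bit u v ≡ suc zero → Adj G u v
  bit⁻ {u} {v} eq with adj? G u v
  ... | yes uv = uv

  encode : Fin (2 ^ (n * n))
  encode = funToFin (uncurry bit ∘ remQuot {n} n)

  encode-bit : ∀ u v → finToFun encode (combine u v) ≡ bit u v
  encode-bit u v =
    trans (Fin.finToFun-funToFin (uncurry bit ∘ remQuot {n} n) (combine u v))
          (cong (uncurry bit) (Fin.remQuot-combine u v))

  decode-encode : G ≈ decode encode
  decode-encode u v = to , from
    where
    to : Adj G u v → Adj (decode encode) u v
    to uv with Fin.<-cmp u v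
    ... | tri< u<v _ _ = inj₁ (u<v , trans (encode-bit u v) (bit⁺ uv))
    ... | tri≈ _ u≡v _ = ⊥-elim (irrefl G u≡v uv)
    ... | tri> _ _ v<u = inj₂ (v<u , trans (encode-bit v u) (bit⁺ (symm G uv)))

    from : Adj (decode encode) u v → Adj G u v
    from (inj₁ (_ , eq)) = bit⁻ (trans (sym (encode-bit u v)) eq)
    from (inj₂ (_ , eq)) = symm G (bit⁻ (trans (sym (encode-bit v u)) eq))

ex-upper : ∀ {k n} (H : Graph k) (G : Graph n) → Free H G → edgeCount G ≤ ex n H
ex-upper {n = n} H G free =
  subst (_≤ ex n H) (sym (edgeCount-resp G G′ (decode-encode G)))
    (lookup (xs≤max 0 (map edgeCount (filter (free? H) (allGraphs n))))
      (∈-map⁺ edgeCount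
        (∈-filter⁺ (free? H) (∈-map⁺ decode (∈-allFin (encode G)))
          (free-resp H G G′ (decode-encode G) free))))
  where
  G′ : Graph n
  G′ = decode (encode G)

edgeless : ∀ n → Graph n
edgeless n = record
  { Adj    = λ _ _ → ⊥
  ; adj?   = λ _ _ → no λ ()
  ; symm   = λ ()
  ; irrefl = λ _ ()
  }

ex-attained : ∀ {k} n (H : Graph k) {u v} → Adj H u v →
              ∃[ G ] Free H G × edgeCount {n} G ≡ ex n H
ex-attained n H {u} {v} uv
  with Extrema.argmax-sel ℕ.≤-totalOrder (λ x → x) 0
         (map edgeCount (filter (free? H) (allGraphs n)))
... | inj₂ ex∈ with ∈-map⁻ edgeCount ex∈
...   | G , G∈ , eq = G , proj₂ (∈-filter⁻ (free? H) {xs = allGraphs n} G∈) , sym eq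
ex-attained n H {u} {v} uv | inj₁ ex≡0 =
  edgeless n , free ,
  ℕ.≤-antisym (ex-upper H (edgeless n) free) (subst (_≤ edgeCount (edgeless n)) (sym ex≡0) z≤n)
  where
  free : Free H (edgeless n)
  free (_ , _ , hom) = hom u v uv

------------------------------------------------------------------------
-- The graphs C₈ and W t

C₈ : Graph 8
C₈ = record
  { Adj    = λ u v → Next u v ⊎ Next v u
  ; adj?   = λ u v → next? u v ⊎-dec next? v u
  ; symm   = swap
  ; irrefl = λ { {u} refl (inj₁ uu) → ¬next u uu ; {u} refl (inj₂ uu) → ¬next u uu }
  }
  where
  Next : Rel (Fin 8) 0ℓ
  Next u v = toℕ v ≡ (toℕ u + 1) % 8

  next? : Decidable Next
  next? u v = toℕ v ℕ.≟ (toℕ u + 1) % 8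

  ¬next : ∀ u → ¬ Next u u
  ¬next = from-yes (Fin.all? λ u → ¬? (next? u u))

-- The i-th of t copies of C₈, glued together at the vertex zero of each copy.
glue : ∀ {t} → Fin t → Fin 8 → Fin (1 + t * 7)
glue i zero    = zero
glue i (suc j) = suc (combine i j)

glue-injective : ∀ {t} (i : Fin t) {a b} → glue i a ≡ glue i b → a ≡ b
glue-injective i {zero}  {zero}  _  = refl
glue-injective i {suc j} {suc k} eq =
  cong suc (Fin.combine-injectiveʳ i j i k (Fin.suc-injective eq))

W : ∀ t → Graph (1 + t * 7)
W t = record
  { Adj    = λ u v → ∃[ i ] ∃[ a ] ∃[ b ] glue {t} i a ≡ u × glue i b ≡ v × Adj C₈ a b
  ; adj?   = λ u v → Fin.any? λ i → Fin.any? λ a → Fin.any? λ b →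
               (glue i a Fin.≟ u) ×-dec (glue i b Fin.≟ v) ×-dec adj? C₈ a b
  ; symm   = λ (i , a , b , a↦u , b↦v , ab) → i , b , a , b↦v , a↦u , symm C₈ ab
  ; irrefl = λ { refl (i , a , b , a↦u , b↦u , ab) →
               irrefl C₈ (glue-injective i (trans a↦u (sym b↦u))) ab }
  }

------------------------------------------------------------------------
-- Asymptotic comparison of functions ℕ → ℕ as the argument tends to ∞

-- Real constants may be rounded up, so natural-number ones suffice.
_=O_ : (ℕ → ℕ) → (ℕ → ℕ) → Set
f =O g = ∃[ C ] ∃[ n₀ ] (∀ n → n₀ ≤ n → f n ≤ C * g n)

_=Θ_ : (ℕ → ℕ) → (ℕ → ℕ) → Set
f =Θ g = (f =O g) × (g =O f)

{-# OPTIONS --safe #-}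

-- Let t = k + 1 and let G be W t-free. Around each vertex v, a maximal family of
-- 8-cycles that pairwise meet only in v has at most k members, so the set S v of their
-- vertices other than v has at most 7k elements and meets every 8-cycle through v.
-- For a random vertex set A, let G_A be the subgraph of G induced on those v ∈ A for which
-- S v misses A: it is C₈-free, since an 8-cycle of G_A through v would meet S v inside A.
-- At most 7kn edges uv have u ∈ S v or v ∈ S u. Any other edge survives in G_A as soon
-- as A meets {u , v} ∪ S u ∪ S v exactly in {u , v}, with probability at least 2^-(14k + 2).

module Submission where

open import Defs
open import Data.Nat.Base using (ℕ; _+_; _*_; _∸_; _^_; _≤_)
open import Data.Product.Base using (_×_)
open import Data.Bool.Base using (Bool; _∧_)
open import Data.Bool.Properties using () renaming (_≟_ to _≟ᵇ_)
open import Data.Fin.Base as Fin using (Fin; zero; suc; combine; splitAt; join; finToFun; funToFin)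
open import Data.Fin.Patterns using (0F; 1F; 2F; 3F)
import Data.Fin.Properties as Fin
open import Data.Fin.Subset using (Subset; inside; outside; ⊥; ⁅_⁆; _∩_; _∪_; _⊆_; ∣_∣) renaming (_∈_ to _∈ₛ_; _∉_ to _∉ₛ_)
open import Data.Fin.Subset.Properties using (∣⊥∣≡0; ∉⊥; x∈⁅x⁆; x∈⁅y⁆⇒x≡y; x∈p∩q⁺; x∈p∩q⁻; x∈p∪q⁺; x∈p∪q⁻; ∪-identityˡ; drop-∷-⊆) renaming (_∈?_ to _∈ₛ?_)
open import Data.List.Base using (List; []; _∷_; _++_; length; map; filter; concatMap; tabulate; allFin; cartesianProduct)
open import Data.List.Membership.Propositional using (_∈_; _∉_)
open import Data.List.Membership.Propositional.Properties using (∈-∃++; ∈-++⁺ˡ; ∈-++⁺ʳ; ∈-++⁻; ∈-map⁺; ∈-filter⁺; ∈-filter⁻; ∈-allFin; ∈-cartesianProduct⁺; ∈-concatMap⁺; ∈-tabulate⁺; ∈-tabulate⁻)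
open import Data.List.Properties using (length-++; length-++-sucʳ; length-map; length-tabulate; filter-++; filter-≐; filter-none)
open import Data.List.Relation.Binary.Subset.Propositional using () renaming (_⊆_ to _⊆ₗ_)
open import Data.List.Relation.Unary.All as All using (All; []; _∷_)
open import Data.List.Relation.Unary.Any as Any using (here; there)
open import Data.List.Relation.Unary.Unique.Propositional using (Unique; []; _∷_)
import Data.List.Relation.Unary.Unique.Propositional.Properties as Unique
open import Data.Nat.Base using (zero; suc; z≤n; s≤s; z<s)
open import Data.Nat.ListAction using (sum)
open import Data.Nat.Properties hiding (_≟_)
open import Algebra.Properties.CommutativeSemigroup +-commutativeSemigroup using (x∙yz≈y∙xz)
open import Data.Product.Base using (∃-syntax; _,_; proj₁; proj₂)
open import Data.Sum.Base using (_⊎_; inj₁; inj₂; [_,_]′; swap)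
open import Data.Vec.Base using ([]; _∷_) renaming (here to hereᵥ)
open import Data.Vec.Properties using (≡-dec; ∷-injectiveˡ; ∷-injectiveʳ)
open import Function.Base using (_∘_; id)
open import Relation.Binary.PropositionalEquality using (_≡_; _≢_; refl; sym; trans; cong; cong₂; subst; module ≡-Reasoning)
open import Relation.Nullary using (¬_; Dec; yes; no; contradiction)
open import Relation.Nullary.Decidable using (map′; ¬?; _×-dec_; _⊎-dec_; from-yes)
open import Relation.Unary using (Pred; Decidable)
open import Level using (0ℓ)

-- Counting in lists

private
  variable
    A B : Set
    n : ℕ

-- Pigeonhole by deletion: the head x is cut out of `ys`, and since x does not recur in `xs`, the
-- tail is still contained in what remains. All comparisons of edge counts below go through this.
Unique⇒length≤ : {xs ys : List A} → Unique xs → xs ⊆ₗ ys → length xs ≤ length ys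
Unique⇒length≤ {xs = []} _ _ = z≤n
Unique⇒length≤ {xs = x ∷ xs} (x∉xs ∷ xs!) xs⊆ys with ∈-∃++ (xs⊆ys (here refl))
... | as , bs , refl = begin
  suc (length xs)         ≤⟨ s≤s (Unique⇒length≤ xs! xs⊆as++bs) ⟩
  suc (length (as ++ bs)) ≡⟨ length-++-sucʳ as x bs ⟨
  length (as ++ x ∷ bs)   ∎
  where
  open ≤-Reasoning
  xs⊆as++bs : xs ⊆ₗ as ++ bs
  xs⊆as++bs z∈xs with ∈-++⁻ as (xs⊆ys (there z∈xs))
  ... | inj₁ z∈as         = ∈-++⁺ˡ z∈as
  ... | inj₂ (here refl)  = contradiction refl (All.lookup x∉xs z∈xs)
  ... | inj₂ (there z∈bs) = ∈-++⁺ʳ as z∈bs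

length-concatMap-≤ : (f : A → List B) {m : ℕ} → (∀ x → length (f x) ≤ m) →
                     ∀ xs → length (concatMap f xs) ≤ length xs * m
length-concatMap-≤ f f≤m []       = z≤n
length-concatMap-≤ f f≤m (x ∷ xs) =
  ≤-trans (≤-reflexive (length-++ (f x)))
          (+-mono-≤ (f≤m x) (length-concatMap-≤ f f≤m xs))

count : {P : Pred A 0ℓ} → Decidable P → List A → ℕ
count P? xs = length (filter P? xs)

count-map : {P : Pred B 0ℓ} (P? : Decidable P) (f : A → B) →
            ∀ xs → count P? (map f xs) ≡ count (P? ∘ f) xs
count-map P? f []       = refl
count-map P? f (x ∷ xs) with P? (f x)
... | yes _ = cong suc (count-map P? f xs)
... | no  _ = count-map P? f xs

module _ {R : A → B → Set} (R? : ∀ x y → Dec (R x y)) where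

  private
    row : List B → A → ℕ
    row ys x = count (R? x) ys

    column : List A → B → ℕ
    column xs y = count (λ x → R? x y) xs

    columns-∷ : ∀ x xs ys → sum (map (column (x ∷ xs)) ys) ≡ row ys x + sum (map (column xs) ys)
    columns-∷ x xs []       = refl
    columns-∷ x xs (y ∷ ys) with R? x y
    ... | yes _ = cong suc (trans (cong (column xs y +_) (columns-∷ x xs ys))
                                  (x∙yz≈y∙xz (column xs y) (row ys x) _))
    ... | no  _ = trans (cong (column xs y +_) (columns-∷ x xs ys))
                        (x∙yz≈y∙xz (column xs y) (row ys x) _)

  double-counting : ∀ xs ys → sum (map (row ys) xs) ≡ sum (map (column xs) ys)
  double-counting []       ys = sym (sum-zeros ys)
    where
    sum-zeros : ∀ ys → sum (map (column []) ys) ≡ 0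
    sum-zeros []       = refl
    sum-zeros (_ ∷ ys) = sum-zeros ys
  double-counting (x ∷ xs) ys =
    trans (cong (row ys x +_) (double-counting xs ys)) (sym (columns-∷ x xs ys))

  -- Expectation over a uniformly chosen y, in integer form: by linearity the mean number of related
  -- x is at least `length xs` divided by C, and it is at most M. The factor `length ys` stays on
  -- both sides for the caller to cancel.
  double-counting-≤ : ∀ {xs ys} C {M} →
    All (λ x → length ys ≤ C * count (R? x) ys) xs →
    (∀ y → count (λ x → R? x y) xs ≤ M) →
    length xs * length ys ≤ C * (length ys * M)
  double-counting-≤ {xs} {ys} C {M} rows columns = begin
    length xs * length ys           ≤⟨ rows≤ rows ⟩
    C * sum (map (row ys) xs)       ≡⟨ cong (C *_) (double-counting xs ys) ⟩
    C * sum (map (column xs) ys)    ≤⟨ *-monoʳ-≤ C (columns≤ ys) ⟩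
    C * (length ys * M)             ∎
    where
    open ≤-Reasoning
    rows≤ : ∀ {zs} → All (λ x → length ys ≤ C * row ys x) zs →
            length zs * length ys ≤ C * sum (map (row ys) zs)
    rows≤ []                 = z≤n
    rows≤ {z ∷ zs} (r ∷ rs) =
      ≤-trans (+-mono-≤ r (rows≤ rs)) (≤-reflexive (sym (*-distribˡ-+ C (row ys z) _)))

    columns≤ : ∀ zs → sum (map (column xs) zs) ≤ length zs * M
    columns≤ []       = z≤n
    columns≤ (z ∷ zs) = +-mono-≤ (columns z) (columns≤ zs)

-- Subsets of Fin n

subsets : ∀ n → List (Subset n)
subsets zero    = [] ∷ []
subsets (suc n) = map (inside ∷_) (subsets n) ++ map (outside ∷_) (subsets n)

length-subsets : ∀ n → length (subsets n) ≡ 2 ^ n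
length-subsets zero    = refl
length-subsets (suc n) = begin
  length (subsets (suc n))                    ≡⟨ length-++ (map (inside ∷_) (subsets n)) ⟩
  length (map (inside ∷_) (subsets n)) + length (map (outside ∷_) (subsets n))
    ≡⟨ cong₂ _+_ (length-map _ (subsets n)) (length-map _ (subsets n)) ⟩
  length (subsets n) + length (subsets n)     ≡⟨ cong₂ _+_ (length-subsets n) (trans (length-subsets n) (sym (+-identityʳ _))) ⟩
  2 ^ suc n                                   ∎
  where open ≡-Reasoning

trace? : (Z X : Subset n) → Decidable (λ A → A ∩ Z ≡ X)
trace? Z X A = ≡-dec _≟ᵇ_ (A ∩ Z) X

count-subsets : {P : Pred (Subset (suc n)) 0ℓ} (P? : Decidable P) →
  count P? (subsets (suc n)) ≡
  count (P? ∘ (inside ∷_)) (subsets n) + count (P? ∘ (outside ∷_)) (subsets n)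
count-subsets {n} P? = begin
  count P? (map (inside ∷_) (subsets n) ++ map (outside ∷_) (subsets n))
    ≡⟨ cong length (filter-++ P? (map (inside ∷_) (subsets n)) _) ⟩
  length (filter P? (map (inside ∷_) (subsets n)) ++ filter P? (map (outside ∷_) (subsets n)))
    ≡⟨ length-++ (filter P? (map (inside ∷_) (subsets n))) ⟩
  count P? (map (inside ∷_) (subsets n)) + count P? (map (outside ∷_) (subsets n))
    ≡⟨ cong₂ _+_ (count-map P? (inside ∷_) (subsets n)) (count-map P? (outside ∷_) (subsets n)) ⟩
  count (P? ∘ (inside ∷_)) (subsets n) + count (P? ∘ (outside ∷_)) (subsets n) ∎
  where open ≡-Reasoning

-- A uniformly random set has trace X on Z with probability 2^-|Z|, multiplied out to stay in the
-- natural numbers. By induction on coordinates: one in Z admits a single choice, one outside Z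
-- leaves both choices open.
count-trace : (Z X : Subset n) → X ⊆ Z → 2 ^ ∣ Z ∣ * count (trace? Z X) (subsets n) ≡ 2 ^ n
count-trace {zero}  []      []      _   = refl
count-trace {suc n} (z ∷ Z) (x ∷ X) X⊆Z =
  trans (cong (2 ^ ∣ z ∷ Z ∣ *_) (count-subsets (trace? (z ∷ Z) (x ∷ X)))) (branches z x X⊆Z)
  where
  open ≡-Reasoning
  c : ℕ
  c = count (trace? Z X) (subsets n)

  branch : Bool → Bool → Bool → ℕ
  branch z x a = count (trace? (z ∷ Z) (x ∷ X) ∘ (a ∷_)) (subsets n)

  same : ∀ z x a → a ∧ z ≡ x → branch z x a ≡ c
  same z x a a∧z≡x = cong length (filter-≐ (trace? (z ∷ Z) (x ∷ X) ∘ (a ∷_)) (trace? Z X)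
    (∷-injectiveʳ , cong₂ _∷_ a∧z≡x) (subsets n))

  different : ∀ z x a → a ∧ z ≢ x → branch z x a ≡ 0
  different z x a a∧z≢x = cong length (filter-none (trace? (z ∷ Z) (x ∷ X) ∘ (a ∷_))
    (All.universal (λ _ → a∧z≢x ∘ ∷-injectiveˡ) (subsets n)))

  branches : ∀ z x → (x ∷ X) ⊆ (z ∷ Z) →
             2 ^ ∣ z ∷ Z ∣ * (branch z x inside + branch z x outside) ≡ 2 ^ suc n
  branches outside inside X⊆Z with () ← X⊆Z hereᵥ
  branches outside outside X⊆Z = begin
    2 ^ ∣ Z ∣ * (branch outside outside inside + branch outside outside outside)
      ≡⟨ cong (2 ^ ∣ Z ∣ *_) (cong₂ _+_ (same outside outside inside refl) (same outside outside outside refl)) ⟩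
    2 ^ ∣ Z ∣ * (c + c)             ≡⟨ *-distribˡ-+ (2 ^ ∣ Z ∣) c c ⟩
    2 ^ ∣ Z ∣ * c + 2 ^ ∣ Z ∣ * c   ≡⟨ cong (λ m → m + m) (count-trace Z X (drop-∷-⊆ X⊆Z)) ⟩
    2 ^ n + 2 ^ n                   ≡⟨ cong (2 ^ n +_) (+-identityʳ _) ⟨
    2 ^ suc n                       ∎
  branches inside x X⊆Z = begin
    2 * 2 ^ ∣ Z ∣ * (branch inside x inside + branch inside x outside)
      ≡⟨ cong (2 * 2 ^ ∣ Z ∣ *_) (one x) ⟩
    2 * 2 ^ ∣ Z ∣ * c     ≡⟨ *-assoc 2 (2 ^ ∣ Z ∣) c ⟩
    2 * (2 ^ ∣ Z ∣ * c)   ≡⟨ cong (2 *_) (count-trace Z X (drop-∷-⊆ X⊆Z)) ⟩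
    2 ^ suc n             ∎
    where
    one : ∀ x → branch inside x inside + branch inside x outside ≡ c
    one inside  = trans (cong₂ _+_ (same inside inside inside refl) (different inside inside outside λ ()))
                        (+-identityʳ c)
    one outside = cong₂ _+_ (different inside outside inside λ ()) (same inside outside outside refl)

fromList : List (Fin n) → Subset n
fromList []       = ⊥
fromList (x ∷ xs) = ⁅ x ⁆ ∪ fromList xs

∈-fromList⁺ : {x : Fin n} {xs : List (Fin n)} → x ∈ xs → x ∈ₛ fromList xs
∈-fromList⁺ (here refl)  = x∈p∪q⁺ (inj₁ (x∈⁅x⁆ _))
∈-fromList⁺ (there x∈xs) = x∈p∪q⁺ (inj₂ (∈-fromList⁺ x∈xs))

∈-fromList⁻ : {x : Fin n} (xs : List (Fin n)) → x ∈ₛ fromList xs → x ∈ xs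
∈-fromList⁻ []       x∈ = contradiction x∈ ∉⊥
∈-fromList⁻ (y ∷ xs) x∈ with x∈p∪q⁻ ⁅ y ⁆ (fromList xs) x∈
... | inj₁ x∈y  = here (x∈⁅y⁆⇒x≡y y x∈y)
... | inj₂ x∈xs = there (∈-fromList⁻ xs x∈xs)

∣⁅x⁆∪p∣≤1+∣p∣ : (x : Fin n) (p : Subset n) → ∣ ⁅ x ⁆ ∪ p ∣ ≤ suc ∣ p ∣
∣⁅x⁆∪p∣≤1+∣p∣ zero    (inside  ∷ p) = s≤s (≤-trans (≤-reflexive (cong ∣_∣ (∪-identityˡ p))) (n≤1+n _))
∣⁅x⁆∪p∣≤1+∣p∣ zero    (outside ∷ p) = s≤s (≤-reflexive (cong ∣_∣ (∪-identityˡ p)))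
∣⁅x⁆∪p∣≤1+∣p∣ (suc x) (inside  ∷ p) = s≤s (∣⁅x⁆∪p∣≤1+∣p∣ x p)
∣⁅x⁆∪p∣≤1+∣p∣ (suc x) (outside ∷ p) = ∣⁅x⁆∪p∣≤1+∣p∣ x p

-- Equality can fail, because entries may repeat; this happens for `zone` when the two hitting sets
-- overlap.
∣fromList∣≤length : (xs : List (Fin n)) → ∣ fromList xs ∣ ≤ length xs
∣fromList∣≤length {n} [] = ≤-reflexive (∣⊥∣≡0 n)
∣fromList∣≤length (x ∷ xs) = ≤-trans (∣⁅x⁆∪p∣≤1+∣p∣ x (fromList xs)) (s≤s (∣fromList∣≤length xs))

-- Edges and induced subgraphs

∈-edges⁺ : (G : Graph n) {u v : Fin n} → u Fin.< v → Adj G u v → (u , v) ∈ edges G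
∈-edges⁺ G {u} {v} u<v uv =
  ∈-filter⁺ (λ (u , v) → (u Fin.<? v) ×-dec adj? G u v)
    (∈-cartesianProduct⁺ (∈-allFin u) (∈-allFin v)) (u<v , uv)

∈-edges⁻ : (G : Graph n) {u v : Fin n} → (u , v) ∈ edges G → u Fin.< v × Adj G u v
∈-edges⁻ {n} G uv∈ =
  proj₂ (∈-filter⁻ (λ (u , v) → (u Fin.<? v) ×-dec adj? G u v)
                   {xs = cartesianProduct (allFin n) (allFin n)} uv∈)

edges-unique : (G : Graph n) → Unique (edges G)
edges-unique {n} G =
  Unique.filter⁺ _ (Unique.cartesianProduct⁺ (Unique.allFin⁺ n) (Unique.allFin⁺ n))

-- The vertex set remains `Fin n`, and vertices outside V become isolated. The edge count is thus
-- bounded by `ex n` with the original n.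
induced : (G : Graph n) {V : Pred (Fin n) 0ℓ} → Decidable V → Graph n
induced G {V} V? = record
  { Adj    = λ u v → Adj G u v × V u × V v
  ; adj?   = λ u v → adj? G u v ×-dec V? u ×-dec V? v
  ; symm   = λ (uv , u∈V , v∈V) → symm G uv , v∈V , u∈V
  ; irrefl = λ u≡v (uv , _) → irrefl G u≡v uv
  }

-- The star

star : ∀ m → Graph (suc m)
star m = record
  { Adj    = λ u v → Spoke u v ⊎ Spoke v u
  ; adj?   = λ u v → spoke? u v ⊎-dec spoke? v u
  ; symm   = swap
  ; irrefl = λ { refl (inj₁ (u≡0 , u≢0)) → u≢0 u≡0 ; refl (inj₂ (u≡0 , u≢0)) → u≢0 u≡0 }
  }
  where
  Spoke : Fin (suc m) → Fin (suc m) → Set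
  Spoke u v = u ≡ zero × v ≢ zero

  spoke? : ∀ u v → Dec (Spoke u v)
  spoke? u v = (u Fin.≟ zero) ×-dec ¬? (v Fin.≟ zero)

-- Every edge of the star contains its centre, but C₈ has two disjoint edges.
star-C₈-free : ∀ m → Free C₈ (star m)
star-C₈-free m (f , inj , hom) with hom 0F 1F (inj₁ refl) | hom 2F 3F (inj₁ refl)
... | inj₁ (p , _) | inj₁ (q , _) with () ← inj (trans p (sym q))
... | inj₁ (p , _) | inj₂ (q , _) with () ← inj (trans p (sym q))
... | inj₂ (p , _) | inj₁ (q , _) with () ← inj (trans p (sym q))
... | inj₂ (p , _) | inj₂ (q , _) with () ← inj (trans p (sym q))

m≤edgeCount-star : ∀ m → m ≤ edgeCount (star m)
m≤edgeCount-star m = begin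
  m                   ≡⟨ length-tabulate spoke ⟨
  length (tabulate spoke) ≤⟨ Unique⇒length≤ (Unique.tabulate⁺ (λ { refl → refl })) spokes⊆ ⟩
  edgeCount (star m)  ∎
  where
  open ≤-Reasoning
  spoke : Fin m → Fin (suc m) × Fin (suc m)
  spoke j = zero , suc j

  spokes⊆ : tabulate spoke ⊆ₗ edges (star m)
  spokes⊆ e∈ with ∈-tabulate⁻ e∈
  ... | j , refl = ∈-edges⁺ (star m) z<s (inj₁ (refl , λ ()))

-- The star has n - 1 edges, which is at least n / 2 once n is at least 2. This absorbs the linear
-- term of the upper bound into the Θ-estimate. At n = 1 the bound fails, as `ex 1 C₈` is 0.
n≤2*ex-C₈ : ∀ n → 2 ≤ n → n ≤ 2 * ex n C₈
n≤2*ex-C₈ (suc zero)    (s≤s ())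
n≤2*ex-C₈ (suc (suc m)) _ = begin
  suc (suc m)                     ≤⟨ s≤s (m≤n+m (suc m) m) ⟩
  suc m + suc m                   ≡⟨ cong (suc m +_) (+-identityʳ (suc m)) ⟨
  2 * suc m                       ≤⟨ *-monoʳ-≤ 2 (≤-trans (m≤edgeCount-star (suc m)) (ex-upper C₈ (star (suc m)) (star-C₈-free (suc m)))) ⟩
  2 * ex (suc (suc m)) C₈         ∎
  where open ≤-Reasoning

-- Cycles through a vertex

C₈-in-W : ∀ k → Contains (W (suc k)) C₈
C₈-in-W k = glue {suc k} zero , glue-injective {suc k} zero , λ a b ab → zero , a , b , refl , refl , ab

-- An extremal H-free graph is also H′-free, since embeddings compose. The edge of H ensures,
-- through `ex-attained`, that an extremal graph exists.
ex-mono : ∀ {j k} n (H : Graph j) (H′ : Graph k) {u v} → Adj H u v → Contains H′ H → ex n H ≤ ex n H′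
ex-mono n H H′ uv (g , g-inj , g-hom) =
  let G , free , eq = ex-attained n H uv in
  ≤-trans (≤-reflexive (sym eq)) (ex-upper H′ G λ (f , f-inj , f-hom) →
    free (f ∘ g , g-inj ∘ f-inj , λ u v uv → f-hom (g u) (g v) (g-hom u v uv)))

ex-C₈≤ex-W : ∀ n k → ex n C₈ ≤ ex n (W (suc k))
ex-C₈≤ex-W n k = ex-mono n C₈ (W (suc k)) {0F} {1F} (inj₁ refl) (C₈-in-W k)

-- Disjoint families of cycles at a vertex, and hitting sets

module _ (G : Graph n) where

  WAt : ℕ → Fin n → Set
  WAt k v = ∃[ f ] IsEmbedding (W k) G f × f zero ≡ v

  -- Up to pointwise equality there are finitely many candidate maps, so a search over their codes
  -- decides existence. `hittingSet` branches on the answer.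
  wAt? : ∀ k v → Dec (WAt k v)
  wAt? k v =
    map′ (λ (c , w) → finToFun {n} {1 + k * 7} c , w)
         (λ (f , emb , f0≡v) → funToFin f ,
           isEmbedding-resp (W k) G (λ x → sym (Fin.finToFun-funToFin f x)) emb ,
           trans (Fin.finToFun-funToFin f zero) f0≡v)
         (Fin.any? λ c → isEmbedding? (W k) G (finToFun c) ×-dec (finToFun {n} {1 + k * 7} c zero Fin.≟ v))

  w₀At : ∀ v → WAt 0 v
  w₀At v = (λ _ → v) , ((λ { {zero} {zero} _ → refl }) , λ { _ _ (() , _) }) , refl

  -- A cycle through the centre that avoids the rest of the copy of `W k` becomes one more petal. It
  -- takes index zero, that is, the first seven rim vertices, and the old petals shift by one.
  extend : ∀ {k f c} → IsEmbedding (W k) G f → IsEmbedding C₈ G c → c zero ≡ f zero →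
           (∀ a x → c (suc a) ≢ f (suc x)) → WAt (suc k) (f zero)
  extend {k} {f} {c} (f-inj , f-hom) (c-inj , c-hom) c0≡f0 apart =
    f′ , (f′-injective _ _ , f′-hom) , refl
    where
    rim : Fin 7 ⊎ Fin (k * 7) → Fin n
    rim = [ c ∘ suc , f ∘ suc ]′

    f′ : Fin (1 + suc k * 7) → Fin n
    f′ zero    = f zero
    f′ (suc x) = rim (splitAt 7 x)

    rim≢centre : ∀ x → rim x ≢ f zero
    rim≢centre (inj₁ a) eq with () ← c-inj (trans eq (sym c0≡f0))
    rim≢centre (inj₂ x) eq with () ← f-inj eq

    rim-injective : ∀ x y → rim x ≡ rim y → x ≡ y
    rim-injective (inj₁ a) (inj₁ b) eq = cong inj₁ (Fin.suc-injective (c-inj eq))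
    rim-injective (inj₁ a) (inj₂ y) eq = contradiction eq (apart a y)
    rim-injective (inj₂ x) (inj₁ b) eq = contradiction (sym eq) (apart b x)
    rim-injective (inj₂ x) (inj₂ y) eq = cong inj₂ (Fin.suc-injective (f-inj eq))

    f′-injective : ∀ x y → f′ x ≡ f′ y → x ≡ y
    f′-injective zero    zero    eq = refl
    f′-injective zero    (suc y) eq = contradiction (sym eq) (rim≢centre (splitAt 7 y))
    f′-injective (suc x) zero    eq = contradiction eq (rim≢centre (splitAt 7 x))
    f′-injective (suc x) (suc y) eq = cong suc
      (trans (sym (Fin.join-splitAt 7 (k * 7) x))
        (trans (cong (join 7 (k * 7)) (rim-injective (splitAt 7 x) (splitAt 7 y) eq))
               (Fin.join-splitAt 7 (k * 7) y)))

    f′-new : ∀ a → c a ≡ f′ (glue {suc k} zero a)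
    f′-new zero    = c0≡f0
    f′-new (suc a) = cong rim (sym (Fin.splitAt-↑ˡ 7 a (k * 7)))

    f′-old : ∀ i a → f (glue i a) ≡ f′ (glue {suc k} (suc i) a)
    f′-old i zero    = refl
    f′-old i (suc a) = cong rim (sym (Fin.splitAt-↑ʳ 7 (k * 7) (combine i a)))

    f′-hom : ∀ u v → Adj (W (suc k)) u v → Adj G (f′ u) (f′ v)
    f′-hom _ _ (zero  , a , b , refl , refl , ab)
      rewrite sym (f′-new a) | sym (f′-new b) = c-hom a b ab
    f′-hom _ _ (suc i , a , b , refl , refl , ab)
      rewrite sym (f′-old i a) | sym (f′-old i b) = f-hom _ _ (i , a , b , refl , refl , ab)

  Hits : List (Fin n) → Fin n → Set
  Hits S v = ∀ c → IsEmbedding C₈ G c → c zero ≡ v → ∃[ j ] c j ∈ S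

  -- The search descends to the largest m ≤ k with a `W m` centred at v, and S is the rim of that
  -- copy: a cycle through v missing S would extend it to `W (suc m)`. The descent stops at the
  -- latest at m = 0, where the copy is the single vertex v.
  hittingSet : ∀ k v → ¬ WAt (suc k) v → ∃[ S ] length S ≤ k * 7 × v ∉ S × Hits S v
  hittingSet k v ¬w with wAt? k v
  hittingSet k v ¬w | yes (f , f-emb@(f-inj , _) , refl) = S , ≤-reflexive (length-tabulate _) , v∉S , hits
    where
    S : List (Fin n)
    S = tabulate (f ∘ suc)

    v∉S : f zero ∉ S
    v∉S v∈S with ∈-tabulate⁻ v∈S
    ... | _ , eq with () ← f-inj eq

    hits : Hits S (f zero)
    hits c c-emb c0≡v with Fin.any? (λ a → Fin.any? (λ x → c (suc a) Fin.≟ f (suc x)))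
    ... | yes (a , x , eq) = suc a , subst (_∈ S) (sym eq) (∈-tabulate⁺ x)
    ... | no  ¬meet        =
      contradiction (extend f-emb c-emb c0≡v λ a x eq → ¬meet (a , x , eq)) ¬w
  hittingSet zero    v ¬w | no ¬w₀ = contradiction (w₀At v) ¬w₀
  hittingSet (suc k) v ¬w | no ¬wₖ with hittingSet k v ¬wₖ
  ... | S , |S|≤ , v∉S , hits = S , ≤-trans |S|≤ (m≤n+m (k * 7) 7) , v∉S , hits

-- The random subgraph

module _ (G : Graph n) (k : ℕ) (S : Fin n → List (Fin n))
         (|S|≤ : ∀ v → length (S v) ≤ k * 7) (v∉Sv : ∀ v → v ∉ S v)
         (hits : ∀ v → Hits G (S v) v) where

  private
    Survives : Subset n → Fin n → Set
    Survives A v = v ∈ₛ A × All (_∉ₛ A) (S v)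

    survives? : ∀ A → Decidable (Survives A)
    survives? A v = (v ∈ₛ? A) ×-dec All.all? (λ w → ¬? (w ∈ₛ? A)) (S v)

    survivors : Subset n → Graph n
    survivors A = induced G (survives? A)

    survivors-C₈-free : ∀ A → Free C₈ (survivors A)
    survivors-C₈-free A (c , c-inj , c-hom)
      with hits (c zero) c (c-inj , λ u v uv → proj₁ (c-hom u v uv)) refl
    ... | j , cj∈S = All.lookup (proj₂ (vertex zero)) cj∈S (proj₁ (vertex j))
      where
      -- Survival is recorded only at the ends of edges of the induced graph, so a vertex of the
      -- cycle is seen to survive through an edge at it.
      neighbour : ∀ j → ∃[ i ] Adj C₈ j i
      neighbour = from-yes (Fin.all? λ j → Fin.any? (adj? C₈ j))

      vertex : ∀ j → Survives A (c j)
      vertex j = proj₁ (proj₂ (c-hom j _ (proj₂ (neighbour j))))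

    -- Exactly for such pairs can a set contain u and v while missing `S u` and `S v`, given that no
    -- vertex lies in its own hitting set.
    Spread : Pred (Fin n × Fin n) 0ℓ
    Spread (u , v) = v ∉ S u × u ∉ S v

    _∈ₗ?_ : (v : Fin n) (xs : List (Fin n)) → Dec (v ∈ xs)
    v ∈ₗ? xs = Any.any? (v Fin.≟_) xs

    spread? : Decidable Spread
    spread? (u , v) = ¬? (v ∈ₗ? S u) ×-dec ¬? (u ∈ₗ? S v)

    spreadEdges : List (Fin n × Fin n)
    spreadEdges = filter spread? (edges G)

    -- `edges` lists each edge with its smaller end first, whereas membership of w in `S u` comes in
    -- either order; sorting makes the pairs comparable.
    orient : Fin n → Fin n → Fin n × Fin n
    orient u v with u Fin.<? v
    ... | yes _ = u , v
    ... | no  _ = v , u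

    orient-< : ∀ {u v} → u Fin.< v → orient u v ≡ (u , v)
    orient-< {u} {v} u<v with u Fin.<? v
    ... | yes _   = refl
    ... | no  u≮v = contradiction u<v u≮v

    orient-> : ∀ {u v} → u Fin.< v → orient v u ≡ (u , v)
    orient-> {u} {v} u<v with v Fin.<? u
    ... | yes v<u = contradiction v<u (<-asym u<v)
    ... | no  _   = refl

    pairsAt : Fin n → List (Fin n × Fin n)
    pairsAt u = map (orient u) (S u)

    -- A superset of the edges that are not spread: the pairs need not be adjacent, and one pair may
    -- occur twice. Only the bound of 7k pairs for each vertex matters.
    closePairs : List (Fin n × Fin n)
    closePairs = concatMap pairsAt (allFin n)

    ∈-closePairs : ∀ {u v} → v ∈ S u → orient u v ∈ closePairs
    ∈-closePairs {u} v∈Su =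
      ∈-concatMap⁺ pairsAt (Any.map (λ { refl → ∈-map⁺ (orient u) v∈Su }) (∈-allFin u))

    length-closePairs : length closePairs ≤ n * (k * 7)
    length-closePairs = subst (λ m → length closePairs ≤ m * (k * 7)) {length (allFin n)} {n} (length-tabulate id)
      (length-concatMap-≤ pairsAt (λ u → ≤-trans (≤-reflexive (length-map (orient u) (S u))) (|S|≤ u)) (allFin n))

    edges⊆ : edges G ⊆ₗ spreadEdges ++ closePairs
    edges⊆ {u , v} uv∈ with ∈-edges⁻ G uv∈ | v ∈ₗ? S u | u ∈ₗ? S v
    ... | u<v , _ | yes v∈Su | _ = ∈-++⁺ʳ spreadEdges (subst (_∈ closePairs) (orient-< u<v) (∈-closePairs v∈Su))
    ... | u<v , _ | no _ | yes u∈Sv = ∈-++⁺ʳ spreadEdges (subst (_∈ closePairs) (orient-> u<v) (∈-closePairs u∈Sv))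
    ... | _ | no v∉Su | no u∉Sv = ∈-++⁺ˡ (∈-filter⁺ spread? uv∈ (v∉Su , u∉Sv))

    -- Sets that are good for an edge

    ends : Fin n × Fin n → List (Fin n)
    ends (u , v) = u ∷ v ∷ []

    zone : Fin n × Fin n → List (Fin n)
    zone (u , v) = ends (u , v) ++ S u ++ S v

    -- Both ends lie in A and nothing else of the zone does. As a single equation on the trace of A,
    -- the event can be counted by `count-trace`.
    Good : Fin n × Fin n → Subset n → Set
    Good e A = A ∩ fromList (zone e) ≡ fromList (ends e)

    good? : ∀ e A → Dec (Good e A)
    good? e = trace? (fromList (zone e)) (fromList (ends e))

    -- The condition on `S x` places it in the part of the zone that a good set avoids.
    good⇒survives : ∀ {e A} → Good e A → ∀ {x} → x ∈ ends e →
                    (∀ {w} → w ∈ S x → w ∈ zone e × w ∉ ends e) → Survives A x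
    good⇒survives {e} {A} good x∈e far =
      proj₁ (x∈p∩q⁻ A _ (subst (_ ∈ₛ_) (sym good) (∈-fromList⁺ x∈e))) ,
      All.tabulate λ w∈Sx w∈A →
        proj₂ (far w∈Sx) (∈-fromList⁻ (ends e)
          (subst (_ ∈ₛ_) good (x∈p∩q⁺ (w∈A , ∈-fromList⁺ (proj₁ (far w∈Sx))))))

    good⇒edge : ∀ A → filter (λ e → good? e A) spreadEdges ⊆ₗ edges (survivors A)
    good⇒edge A {u , v} e∈ with ∈-filter⁻ (λ e → good? e A) {xs = spreadEdges} e∈
    ... | e∈spread , good with ∈-filter⁻ spread? {xs = edges G} e∈spread
    ... | e∈G , (v∉Su , u∉Sv) with ∈-edges⁻ G e∈G
    ... | u<v , uv = ∈-edges⁺ (survivors A) u<v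
      ( uv
      -- `S u` misses u by the choice of hitting sets and misses v because the edge is spread;
      -- symmetrically for `S v` below.
      , good⇒survives {u , v} good (here refl) (λ w∈Su →
          there (there (∈-++⁺ˡ w∈Su)) ,
          λ { (here refl) → v∉Sv u w∈Su ; (there (here refl)) → v∉Su w∈Su })
      , good⇒survives {u , v} good (there (here refl)) (λ w∈Sv →
          there (there (∈-++⁺ʳ (S u) w∈Sv)) ,
          λ { (here refl) → u∉Sv w∈Sv ; (there (here refl)) → v∉Sv v w∈Sv }))

    -- For a fixed A, the spread edges for which it is good all survive in one C₈-free graph on n
    -- vertices.
    fewGoodEdges : ∀ A → count (λ e → good? e A) spreadEdges ≤ ex n C₈
    fewGoodEdges A = ≤-trans
      (Unique⇒length≤ (Unique.filter⁺ (λ e → good? e A) (Unique.filter⁺ spread? (edges-unique G))) (good⇒edge A))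
      (ex-upper C₈ (survivors A) (survivors-C₈-free A))

    -- Two ends and two hitting sets of at most 7k vertices each; this is the source of the exponent
    -- in the final bound.
    length-zone : ∀ e → length (zone e) ≤ 14 * k + 2
    length-zone (u , v) = begin
      2 + length (S u ++ S v)           ≡⟨ cong (2 +_) (length-++ (S u)) ⟩
      2 + (length (S u) + length (S v)) ≤⟨ +-monoʳ-≤ 2 (+-mono-≤ (|S|≤ u) (|S|≤ v)) ⟩
      2 + (k * 7 + k * 7)               ≡⟨ cong (2 +_) (*-distribˡ-+ k 7 7) ⟨
      2 + k * 14                        ≡⟨ +-comm 2 (k * 14) ⟩
      k * 14 + 2                        ≡⟨ cong (_+ 2) (*-comm k 14) ⟩
      14 * k + 2                        ∎
      where open ≤-Reasoning

    manyGoodSets : ∀ e → length (subsets n) ≤ 2 ^ (14 * k + 2) * count (good? e) (subsets n)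
    manyGoodSets e = begin
      length (subsets n)                                      ≡⟨ length-subsets n ⟩
      2 ^ n                                                   ≡⟨ count-trace (fromList (zone e)) (fromList (ends e)) ends⊆zone ⟨
      2 ^ ∣ fromList (zone e) ∣ * count (good? e) (subsets n) ≤⟨ *-monoˡ-≤ _ (^-monoʳ-≤ 2 (≤-trans (∣fromList∣≤length (zone e)) (length-zone e))) ⟩
      2 ^ (14 * k + 2) * count (good? e) (subsets n)          ∎
      where
      open ≤-Reasoning
      ends⊆zone : fromList (ends e) ⊆ fromList (zone e)
      ends⊆zone x∈ = ∈-fromList⁺ {xs = zone e} (∈-++⁺ˡ (∈-fromList⁻ (ends e) x∈))

    -- Pairs of a spread edge and a set good for it are counted in both orders, by `manyGoodSets`
    -- and `fewGoodEdges`. The number `2 ^ n` of all sets is a common factor and cancels.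
    length-spreadEdges : length spreadEdges ≤ 2 ^ (14 * k + 2) * ex n C₈
    length-spreadEdges = *-cancelʳ-≤ _ _ (2 ^ n) {{m^n≢0 2 n}} (begin
      length spreadEdges * 2 ^ n                        ≡⟨ cong (length spreadEdges *_) (length-subsets n) ⟨
      length spreadEdges * length (subsets n)           ≤⟨ double-counting-≤ good? {spreadEdges} {subsets n} C (All.universal manyGoodSets spreadEdges) fewGoodEdges ⟩
      C * (length (subsets n) * ex n C₈)                ≡⟨ cong (λ m → C * (m * ex n C₈)) (length-subsets n) ⟩
      C * (2 ^ n * ex n C₈)                             ≡⟨ cong (C *_) (*-comm (2 ^ n) _) ⟩
      C * (ex n C₈ * 2 ^ n)                             ≡⟨ *-assoc C _ _ ⟨
      C * ex n C₈ * 2 ^ n                               ∎)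
      where
      open ≤-Reasoning
      C : ℕ
      C = 2 ^ (14 * k + 2)

  edgeCount-≤ : edgeCount G ≤ 2 ^ (14 * k + 2) * ex n C₈ + 7 * k * n
  edgeCount-≤ = begin
    edgeCount G                             ≤⟨ Unique⇒length≤ (edges-unique G) edges⊆ ⟩
    length (spreadEdges ++ closePairs)      ≡⟨ length-++ spreadEdges ⟩
    length spreadEdges + length closePairs  ≤⟨ +-mono-≤ length-spreadEdges length-closePairs ⟩
    _ + n * (k * 7)                         ≡⟨ cong (2 ^ (14 * k + 2) * ex n C₈ +_) (trans (*-comm n (k * 7)) (cong (_* n) (*-comm k 7))) ⟩
    2 ^ (14 * k + 2) * ex n C₈ + 7 * k * n  ∎
    where open ≤-Reasoning

-- Bounds on the extremal numbers

ex-W≤ : ∀ n k → ex n (W (suc k)) ≤ 2 ^ (14 * k + 2) * ex n C₈ + 7 * k * n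
ex-W≤ n k =
  -- `ex-attained` asks for an edge of the forbidden graph; the first edge of the first petal
  -- serves.
  let G , free , eq = ex-attained n (W (suc k)) (proj₂ (proj₂ (C₈-in-W k)) 0F 1F (inj₁ refl))
      -- A `W (suc k)` centred at v is in particular a copy in G, so freeness excludes it at every
      -- vertex.
      S = λ v → hittingSet G k v λ (f , emb , _) → free (f , emb)
  in subst (_≤ 2 ^ (14 * k + 2) * ex n C₈ + 7 * k * n) eq
       (edgeCount-≤ G k (proj₁ ∘ S) (proj₁ ∘ proj₂ ∘ S) (proj₁ ∘ proj₂ ∘ proj₂ ∘ S) (proj₂ ∘ proj₂ ∘ proj₂ ∘ S))

-- The summand `7 * k * 2` is what the linear term costs after `n≤2*ex-C₈`, which is also where the
-- restriction on n comes from.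
ex-W≤*ex-C₈ : ∀ k n → 2 ≤ n → ex n (W (suc k)) ≤ (2 ^ (14 * k + 2) + 7 * k * 2) * ex n C₈
ex-W≤*ex-C₈ k n 2≤n = begin
  ex n (W (suc k))                                        ≤⟨ ex-W≤ n k ⟩
  2 ^ (14 * k + 2) * ex n C₈ + 7 * k * n                  ≤⟨ +-monoʳ-≤ (2 ^ (14 * k + 2) * ex n C₈) (*-monoʳ-≤ (7 * k) (n≤2*ex-C₈ n 2≤n)) ⟩
  2 ^ (14 * k + 2) * ex n C₈ + 7 * k * (2 * ex n C₈)      ≡⟨ cong (2 ^ (14 * k + 2) * ex n C₈ +_) (*-assoc (7 * k) 2 _) ⟨
  2 ^ (14 * k + 2) * ex n C₈ + 7 * k * 2 * ex n C₈        ≡⟨ *-distribʳ-+ (ex n C₈) (2 ^ (14 * k + 2)) (7 * k * 2) ⟨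
  (2 ^ (14 * k + 2) + 7 * k * 2) * ex n C₈                ∎
  where open ≤-Reasoning

propositionA1 : (t : ℕ) → 1 ≤ t →
    ((λ n → ex n (W t)) =Θ (λ n → ex n C₈))
    × ((n : ℕ) → (ex n C₈ ≤ ex n (W t))
    × (ex n (W t) ≤ 2 ^ (14 * (t ∸ 1) + 2) * ex n C₈ + 7 * (t ∸ 1) * n))
propositionA1 (suc k) _ =
  -- With t = `suc k`, `t ∸ 1` reduces to k. The threshold 2 is that of the star bound; the reverse
  -- comparison holds with constant 1 from n = 0 on.
  ( (2 ^ (14 * k + 2) + 7 * k * 2 , 2 , ex-W≤*ex-C₈ k)
  , (1 , 0 , λ n _ → ≤-trans (ex-C₈≤ex-W n k) (≤-reflexive (sym (*-identityˡ _)))))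
  , λ n → ex-C₈≤ex-W n k , ex-W≤ n k
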